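{- Let $D$ be an oriented graph with $n$ vertices containing no transmitter. Then there exists an oriented graph $D_2$ containing $D$ as an induced suboriented graph such that the set of weak kings of $D_2$ is exactly the vertex set of $D$.
   Context: An oriented graph is a digraph with no loops and no pair of symmetric arcs. A transmitter is a vertex of indegree $0$. For vertices $u,v$ write $u(1\text{ - }0)v$ if there is an arc from $u$ to $v$, and $u(0\text{ - }0)v$ if there is no arc between $u$ and $v$. A vertex $v$ is weakly reachable within two steps from $u$ if $u(1\text{ - }0)v$, or $u(0\text{ - }0)v$, or for some vertex $w$ one has $u(1\text{ - }0)w(1\text{ - }0)v$, or $u(1\text{ - }0)w(0\text{ - }0)v$, or $u(0\text{ - }0)w(1\text{ - }0)v$. A vertex $u$ of an oriented graph is a weak king if every other vertex is weakly reachable within two steps from $u$. -}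

module Defs where

open import Data.Nat using (ℕ)
open import Data.Fin using (Fin)
open import Data.List using (length; filter; allFin)
open import Data.Product using (_×_; ∃-syntax)
open import Data.Sum using (_⊎_)
open import Function.Bundles using (_⇔_)
open import Function.Definitions using (Injective)
open import Level using (0ℓ)
open import Relation.Binary.Core using (Rel)
open import Relation.Binary.Definitions using (Asymmetric; Decidable; Irreflexive)
open import Relation.Binary.PropositionalEquality using (_≡_; _≢_)
open import Relation.Nullary using (¬_)

-- Decidability of the arc relation makes this a finite digraph in the usual
-- sense (a 0/1 adjacency matrix).
record OrientedGraph (n : ℕ) : Set₁ where
  field
    Arc     : Rel (Fin n) 0ℓ
    arc?    : Decidable Arc
    irrefl  : Irreflexive _≡_ Arc
    asym    : Asymmetric Arc

module _ {n : ℕ} (D : OrientedGraph n) where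
  open OrientedGraph D

  -- u (0-0) v.  This also holds for u ≡ v, which does not affect WeakKing:
  -- for u ≢ v, each two-step clause whose (0-0) step stays at one vertex
  -- reduces to Arc u v or to a loop.
  NonAdjacent : Rel (Fin n) 0ℓ
  NonAdjacent u v = ¬ Arc u v × ¬ Arc v u

  indegree : Fin n → ℕ
  indegree v = length (filter (λ u → arc? u v) (allFin n))

  Transmitter : Fin n → Set
  Transmitter v = indegree v ≡ 0

  WeaklyReachable : Rel (Fin n) 0ℓ
  WeaklyReachable u v =
      Arc u v
    ⊎ NonAdjacent u v
    ⊎ (∃[ w ] (  (Arc u w × Arc w v)
               ⊎ (Arc u w × NonAdjacent w v)
               ⊎ (NonAdjacent u w × Arc w v)))

  WeakKing : Fin n → Set
  WeakKing u = ∀ v → v ≢ u → WeaklyReachable u v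

-- f identifies D with the suboriented graph of E induced on the image of f.
record IsInducedEmbedding {n m : ℕ} (D : OrientedGraph n) (E : OrientedGraph m)
                          (f : Fin n → Fin m) : Set where
  field
    injective : Injective _≡_ _≡_ f
    arcs      : ∀ u v → OrientedGraph.Arc D u v ⇔ OrientedGraph.Arc E (f u) (f v)

{-# OPTIONS --safe #-}
-- Add to D one new vertex j′ for each vertex j, with arcs to j′ from every
-- vertex of D except j, and no other new arcs.  Each i of D is a weak king,
-- since i (1-0) j′ (0-0) j for i ≢ j.  No j′ is one: j has an in-neighbour k
-- because it is not a transmitter; k dominates j′, which has no out-neighbour,
-- and no vertex non-adjacent to j′ (that is, j or a new vertex) dominates k.
module Submission where

open import Data.Empty using (⊥)
open import Data.Nat using (ℕ; _+_)
open import Data.Fin using (Fin; splitAt; _↑ˡ_; _↑ʳ_; _≟_)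
open import Data.Fin.Properties using (any?; splitAt-↑ˡ; splitAt-↑ʳ; splitAt⁻¹-↑ˡ; ↑ˡ-injective)
open import Data.List using (length; allFin)
open import Data.List.Properties using (filter-none)
open import Data.List.Relation.Unary.All using (universal)
open import Data.Product using (Σ-syntax; ∃-syntax; _×_; _,_; proj₂)
open import Data.Sum using (_⊎_; inj₁; inj₂)
open import Function.Base using (id)
open import Function.Bundles using (_⇔_; mk⇔)
open import Level using (0ℓ)
open import Relation.Binary.Core using (Rel)
open import Relation.Binary.Definitions using (Asymmetric; Decidable; Irreflexive)
open import Relation.Binary.PropositionalEquality using (_≡_; _≢_; refl; cong; sym; trans)
open import Relation.Nullary using (¬_; yes; no; contradiction; ¬?)
open import Defs

-- If no arc entered `v`, the filter behind `indegree` would keep nothing and `v` would be a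
-- transmitter.
in-neighbour : ∀ {n} (D : OrientedGraph n) v → ¬ Transmitter D v → ∃[ u ] OrientedGraph.Arc D u v
in-neighbour {n} D v ¬t with any? (λ u → OrientedGraph.arc? D u v)
... | yes p = p
... | no ¬p = contradiction (cong length (filter-none arcTo? (universal (λ u a → ¬p (u , a)) (allFin n)))) ¬t
  where arcTo? = λ u → OrientedGraph.arc? D u v

module Extension {n : ℕ} (D : OrientedGraph n) where
  open OrientedGraph D

  -- `inj₂ j` stands for j′. The last clause leaves the head of the arc unsplit, so an arc out of a
  -- new vertex reduces to `⊥` even when its head is unknown.
  Arc⊎ : Rel (Fin n ⊎ Fin n) 0ℓ
  Arc⊎ (inj₁ u) (inj₁ v) = Arc u v
  Arc⊎ (inj₁ u) (inj₂ j) = u ≢ j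
  Arc⊎ (inj₂ _) _        = ⊥

  arc⊎? : Decidable Arc⊎
  arc⊎? (inj₁ u) (inj₁ v) = arc? u v
  arc⊎? (inj₁ u) (inj₂ j) = ¬? (u ≟ j)
  arc⊎? (inj₂ _) _        = no λ ()

  irrefl⊎ : Irreflexive _≡_ Arc⊎
  irrefl⊎ {inj₁ u} refl = irrefl refl
  irrefl⊎ {inj₂ j} refl ()

  asym⊎ : Asymmetric Arc⊎
  asym⊎ {inj₁ u} {inj₁ v} a b = asym a b
  asym⊎ {inj₁ u} {inj₂ j} a ()

  extension : OrientedGraph (n + n)
  extension = record
    { Arc    = λ x y → Arc⊎ (splitAt n x) (splitAt n y)
    ; arc?   = λ x y → arc⊎? (splitAt n x) (splitAt n y)
    ; irrefl = λ x≡y → irrefl⊎ (cong (splitAt n) x≡y)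
    ; asym   = λ {x} {y} → asym⊎ {splitAt n x} {splitAt n y}
    }

  old : Fin n → Fin (n + n)
  old u = u ↑ˡ n

  old-isInducedEmbedding : IsInducedEmbedding D extension old
  old-isInducedEmbedding = record
    { injective = ↑ˡ-injective n _ _
    ; arcs      = arcs
    }
    where
    arcs : ∀ u v → Arc u v ⇔ OrientedGraph.Arc extension (old u) (old v)
    arcs u v rewrite splitAt-↑ˡ n u n | splitAt-↑ˡ n v n = mk⇔ id id

  -- Here and below, vertices are variables with a known value of `splitAt`, so that rewriting
  -- evaluates the arcs of `extension` through `Arc⊎`.
  reach-old : ∀ i j → i ≢ j → ∀ x y → splitAt n x ≡ inj₁ i → splitAt n y ≡ inj₁ j →
              WeaklyReachable extension x y
  reach-old i j i≢j x y x≡i y≡j = inj₂ (inj₂ (n ↑ʳ j , inj₂ (inj₁ (dominates , apart))))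
    where
    dominates : OrientedGraph.Arc extension x (n ↑ʳ j)
    dominates rewrite x≡i | splitAt-↑ʳ n n j = i≢j
    apart : NonAdjacent extension (n ↑ʳ j) y
    apart rewrite y≡j | splitAt-↑ʳ n n j = (λ ()) , λ j≢j → j≢j refl

  -- One step suffices: the omitted arc from `j` to j′ leaves that pair non-adjacent, and every
  -- other old vertex dominates j′.
  reach-new : ∀ i j x y → splitAt n x ≡ inj₁ i → splitAt n y ≡ inj₂ j →
              WeaklyReachable extension x y
  reach-new i j x y x≡i y≡j rewrite x≡i | y≡j with i ≟ j
  ... | yes i≡j = inj₂ (inj₁ ((λ i≢j → i≢j i≡j) , λ ()))
  ... | no  i≢j = inj₁ i≢j

  old-weakKing : ∀ i → WeakKing extension (old i)
  old-weakKing i y y≢i = go (splitAt n y) refl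
    where
    go : ∀ s → splitAt n y ≡ s → WeaklyReachable extension (old i) y
    go (inj₁ j) y≡j = reach-old i j (λ { refl → y≢i (sym (splitAt⁻¹-↑ˡ y≡j)) })
                                _ y (splitAt-↑ˡ n i n) y≡j
    go (inj₂ j) y≡j = reach-new i j _ y (splitAt-↑ˡ n i n) y≡j

  in-neighbour-unreachable : ∀ {j k} → Arc k j → ∀ x y → splitAt n x ≡ inj₂ j → splitAt n y ≡ inj₁ k →
                             ¬ WeaklyReachable extension x y
  in-neighbour-unreachable {j} {k} k→j x y x≡j y≡k r rewrite x≡j | y≡k with r
  -- Clauses that begin with an arc out of j′ are empty. Non-adjacency of j′ and `k` would force `k`
  -- to equal `j`, giving a loop.
  ... | inj₂ (inj₁ (_ , ¬k≢j)) = ¬k≢j λ k≡j → irrefl k≡j k→j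
  -- An intermediate `w` that dominates `k` must be old, and its non-adjacency to j′ makes it `j`;
  -- its arc to `k` then reverses `k→j`.
  ... | inj₂ (inj₂ (w , inj₂ (inj₂ ((_ , ¬w→x) , w→y)))) with splitAt n w
  ...   | inj₁ u with u ≟ j
  ...     | yes refl = asym k→j w→y
  ...     | no  u≢j  = ¬w→x u≢j

  new-¬weakKing : ∀ {j k} → Arc k j → ∀ x → splitAt n x ≡ inj₂ j → ¬ WeakKing extension x
  new-¬weakKing {j} {k} k→j x x≡j king =
    in-neighbour-unreachable k→j x (old k) x≡j (splitAt-↑ˡ n k n) (king (old k) old≢x)
    where
    old≢x : old k ≢ x
    old≢x refl with () ← trans (sym x≡j) (splitAt-↑ˡ n k n)

theorem10 : (n : ℕ) (D : OrientedGraph n) → (∀ v → ¬ Transmitter D v) →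
    Σ[ m ∈ ℕ ] Σ[ D₂ ∈ OrientedGraph m ] Σ[ f ∈ (Fin n → Fin m) ]
    (IsInducedEmbedding D D₂ f × (∀ x → WeakKing D₂ x ⇔ (∃[ v ] f v ≡ x)))
theorem10 n D noTransmitter =
  n + n , extension , old , old-isInducedEmbedding , λ x → mk⇔ (isOld x) λ { (v , refl) → old-weakKing v }
  where
  open Extension D
  isOld : ∀ x → WeakKing extension x → ∃[ v ] old v ≡ x
  isOld x king = go (splitAt n x) refl
    where
    go : ∀ s → splitAt n x ≡ s → ∃[ v ] old v ≡ x
    go (inj₁ v) x≡v = v , splitAt⁻¹-↑ˡ x≡v
    -- The absence of transmitters enters here: it supplies the in-neighbour of `j` that `x` fails
    -- to reach.
    go (inj₂ j) x≡j = contradiction king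
      (new-¬weakKing (proj₂ (in-neighbour D j (noTransmitter j))) x x≡j)
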